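{- Let $(N_1,m_1)$ and $(N_2,m_2)$ be labeled marked Petri nets and $E$ a system of linear constraints with $(N_1,m_1)\vartriangleright_E(N_2,m_2)$. Then for any label $a$ and any symbol $b$ (possibly the silent symbol $\tau$), $(N_1[a/b],m_1)\vartriangleright_E(N_2[a/b],m_2)$.
   Context: A Petri net $N=(P,T,\mathrm{Pre},\mathrm{Post})$ has a finite set of places $P$, a finite set of transitions $T$ disjoint from $P$, and flow functions $\mathrm{Pre},\mathrm{Post}:T\to(P\to\mathbb N)$. A marking is a map $m:P\to\mathbb N$. Transition $t$ is enabled at $m$ if $m(p)\ge\mathrm{Pre}(t,p)$ for all $p$; firing it yields $m'=m-\mathrm{Pre}(t)+\mathrm{Post}(t)$. A firing sequence $\varrho$ leads from $m$ to $m'$ ($m\overset{\varrho}{\Rightarrow}m'$) if its transitions can be fired successively from $m$ reaching $m'$. A labeled net has a labeling $l:T\to\Sigma\cup\{\tau\}$ ($\tau\notin\Sigma$ silent), extended to sequences by $l(\epsilon)=\epsilon$, $\tau$ mapped to $\epsilon$, $l(\varrho t)=l(\varrho)l(t)$. Formulas are Boolean combinations of linear (in)equalities over integer variables; place names are used as variables. For a marking $m$ over $P$, $\underline m\triangleq\bigwedge_{p\in P}(p=m(p))$; $m\models\phi$ means $\phi\wedge\underline m$ is satisfiable over the integers. Markings $m_1$ over $P_1$, $m_2$ over $P_2$ are compatible if they agree on $P_1\cap P_2$; then $m_1\uplus m_2$ is the marking on $P_1\cup P_2$ agreeing with both; $m_1\uplus m_2\models E$ presupposes compatibility. $E$-abstraction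 (for $N_1,N_2$ with labelings $l_1,l_2$ over the same alphabet): $(N_1,m_1)\sqsupseteq_E(N_2,m_2)$ iff (A1) $m_1\uplus m_2\models E$; and (A2) for every firing sequence $m_1\overset{\varrho_1}{\Rightarrow}m_1'$ in $N_1$ there is at least one marking $m_2'$ over $P_2$ with $m_1'\uplus m_2'\models E$, and for every marking $m_2'$ over $P_2$ with $m_1'\uplus m_2'\models E$ there is a firing sequence $\varrho_2$ of $N_2$ with $m_2\overset{\varrho_2}{\Rightarrow}m_2'$ and $l_1(\varrho_1)=l_2(\varrho_2)$. $(N_1,m_1)\vartriangleright_E(N_2,m_2)$ means both directions hold. Relabeling: if $N$ has labeling $l$ over $\Sigma$, $N[a/b]$ is the same net with labeling $l[a/b]$ over $(\Sigma\setminus\{a\})\cup\{b\}$, where $l[a/b](t)=b$ if $l(t)=a$ and $l[a/b](t)=l(t)$ otherwise. -}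

module Defs where

open import Data.Bool.Base using (if_then_else_)
open import Data.Integer.Base as ℤ using (ℤ; +_)
open import Data.List.Base using (List; []; _∷_; _++_; filter; mapMaybe)
open import Data.List.Membership.Propositional using (_∈_)
import Data.List.Membership.DecPropositional as DecMembership
open import Data.List.Relation.Binary.Disjoint.Propositional using (Disjoint)
open import Data.List.Relation.Unary.All as All using (All; []; _∷_)
open import Data.List.Relation.Unary.All.Properties using (++⁺; filter⁺)
open import Data.List.Relation.Unary.Unique.Propositional using (Unique)
open import Data.Maybe.Base using (Maybe; just; nothing)
open import Data.Maybe.Relation.Unary.All as Maybe using (just; nothing)
open import Data.Nat.Base as ℕ using (ℕ)
open import Data.Product.Base using (∃; _×_; _,_)
open import Data.Sum.Base using (_⊎_; inj₁; inj₂)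
open import Data.Unit.Base using (⊤)
open import Level using (0ℓ)
open import Relation.Binary.Definitions using (DecidableEquality)
open import Relation.Binary.PropositionalEquality.Core using (_≡_; refl; sym)
open import Relation.Nullary.Decidable.Core using (does; yes; no)
open import Relation.Nullary.Negation.Core using (¬_)
open import Relation.Unary using (Pred; ｛_｝; _∪_; _∖_)

-- `Name` supplies the names of places and transitions, and the variables of
-- formulas, so that distinct nets may share places and a formula may use
-- variables that name no place. `Symbol` is the universe from which
-- alphabets are drawn; it does not contain τ.
module PetriNets {Name Symbol : Set}
                 (_≟ₙ_ : DecidableEquality Name)
                 (_≟ₛ_ : DecidableEquality Symbol) where

  open DecMembership _≟ₙ_ using (_∉?_)

  infixl 7 _·_
  infixl 6 _⊕_
  infix  5 _≐_ _≼_ _≺_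
  infixr 4 _∧′_
  infixr 3 _∨′_

  data Term : Set where
    const : ℤ → Term
    _·_   : ℤ → Name → Term
    _⊕_   : Term → Term → Term

  data Formula : Set where
    _≐_ _≼_ _≺_ : Term → Term → Formula
    true′       : Formula
    ¬′_         : Formula → Formula
    _∧′_ _∨′_   : Formula → Formula → Formula

  Valuation : Set
  Valuation = Name → ℤ

  eval : Valuation → Term → ℤ
  eval v (const k) = k
  eval v (k · x)   = k ℤ.* v x
  eval v (s ⊕ t)   = eval v s ℤ.+ eval v t

  Holds : Valuation → Formula → Set
  Holds v (s ≐ t)  = eval v s ≡ eval v t
  Holds v (s ≼ t)  = eval v s ℤ.≤ eval v t
  Holds v (s ≺ t)  = eval v s ℤ.< eval v t
  Holds v true′    = ⊤
  Holds v (¬′ φ)   = ¬ Holds v φ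
  Holds v (φ ∧′ ψ) = Holds v φ × Holds v ψ
  Holds v (φ ∨′ ψ) = Holds v φ ⊎ Holds v ψ

  Satisfiable : Formula → Set
  Satisfiable φ = ∃ λ v → Holds v φ

  -- A map P → ℕ, tabulated along the list P, so that _≡_ on markings is
  -- pointwise equality. m(p) is `All.lookup m p∈P`.
  Marking : List Name → Set
  Marking P = All (λ _ → ℕ) P

  ⌜_⌝ : ∀ {P} → Marking P → Formula
  ⌜ [] ⌝              = true′
  ⌜ _∷_ {x = p} k m ⌝ = (+ 1 · p ≐ const (+ k)) ∧′ ⌜ m ⌝

  infix 4 _⊨_ _⨄_⊨_
  infixr 5 _∪ₚ_ _⊎ₘ_

  _⊨_ : ∀ {P} → Marking P → Formula → Set
  m ⊨ φ = Satisfiable (φ ∧′ ⌜ m ⌝)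

  Compatible : ∀ {P₁ P₂} → Marking P₁ → Marking P₂ → Set
  Compatible {P₁} {P₂} m₁ m₂ =
    ∀ {p} (i : p ∈ P₁) (j : p ∈ P₂) → All.lookup m₁ i ≡ All.lookup m₂ j

  -- Names in both lists are kept only in the first, so the union of
  -- duplicate-free lists is duplicate-free.
  _∪ₚ_ : List Name → List Name → List Name
  P₁ ∪ₚ P₂ = P₁ ++ filter (_∉? P₁) P₂

  -- Only meaningful for compatible markings; otherwise biased to the left.
  _⊎ₘ_ : ∀ {P₁ P₂} → Marking P₁ → Marking P₂ → Marking (P₁ ∪ₚ P₂)
  _⊎ₘ_ {P₁} m₁ m₂ = ++⁺ m₁ (filter⁺ (_∉? P₁) m₂)

  _⨄_⊨_ : ∀ {P₁ P₂} → Marking P₁ → Marking P₂ → Formula → Set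
  m₁ ⨄ m₂ ⊨ E = Compatible m₁ m₂ × (m₁ ⊎ₘ m₂) ⊨ E

  record Net : Set where
    field
      places             : List Name
      transitions        : List Name
      places-unique      : Unique places
      transitions-unique : Unique transitions
      disjoint           : Disjoint places transitions

    -- Membership proofs are unique because the list has no duplicates.
    Transition : Set
    Transition = ∃ (_∈ transitions)

    field
      pre post : Transition → Marking places

  module _ (N : Net) where
    open Net N

    Enabled : Marking places → Transition → Set
    Enabled m t = ∀ {p} (i : p ∈ places) → All.lookup (pre t) i ℕ.≤ All.lookup m i

    record Fires (m : Marking places) (t : Transition) (m′ : Marking places) : Set where
      field
        enabled : Enabled m t
        result  : ∀ {p} (i : p ∈ places) →
                  All.lookup m′ i ≡
                  (All.lookup m i ℕ.∸ All.lookup (pre t) i) ℕ.+ All.lookup (post t) i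

    data FiringSequence : Marking places → List Transition → Marking places → Set where
      []  : ∀ {m} → FiringSequence m [] m
      _∷_ : ∀ {m t m′ ϱ m″} →
            Fires m t m′ → FiringSequence m′ ϱ m″ → FiringSequence m (t ∷ ϱ) m″

  Alphabet : Set₁
  Alphabet = Pred Symbol 0ℓ

  -- `nothing` is the silent symbol τ.
  Label : Set
  Label = Maybe Symbol

  record LabeledNet (Σ : Alphabet) : Set where
    field
      net : Net
    open Net net public
    field
      label    : Transition → Label
      label∈Στ : ∀ t → Maybe.All Σ (label t)

    labels : List Transition → List Symbol
    labels = mapMaybe label

  -- If b is τ, nothing is added to Σ ∖ {a}.
  _[_/_]ₐ : Alphabet → Symbol → Label → Alphabet
  Σ [ a / b ]ₐ = (Σ ∖ ｛ a ｝) ∪ (λ s → just s ≡ b)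

  relabel : Symbol → Label → Label → Label
  relabel a b nothing  = nothing
  relabel a b (just s) = if does (s ≟ₛ a) then b else just s

  relabel-∈ : ∀ {Σ} a b {x} → Maybe.All Σ x → Maybe.All (Σ [ a / b ]ₐ) (relabel a b x)
  relabel-∈ a b nothing = nothing
  relabel-∈ a b (just {x = s} s∈Σ) with s ≟ₛ a
  relabel-∈ a nothing  (just s∈Σ) | yes _ = nothing
  relabel-∈ a (just b) (just s∈Σ) | yes _ = just (inj₂ refl)
  ... | no s≢a = just (inj₁ (s∈Σ , λ a≡s → s≢a (sym a≡s)))

  _[_/_] : ∀ {Σ} → LabeledNet Σ → (a : Symbol) (b : Label) → LabeledNet (Σ [ a / b ]ₐ)
  N [ a / b ] = record
    { net      = net
    ; label    = λ t → relabel a b (label t)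
    ; label∈Στ = λ t → relabel-∈ a b (label∈Στ t)
    }
    where open LabeledNet N

  record MarkedNet (Σ : Alphabet) : Set where
    constructor ⟨_,_⟩
    field
      labeledNet : LabeledNet Σ
    open LabeledNet labeledNet public
    field
      initial : Marking places

  infix 4 _⊒[_]_ _▷[_]_

  record _⊒[_]_ {Σ : Alphabet} (M₁ : MarkedNet Σ) (E : Formula) (M₂ : MarkedNet Σ) : Set where
    private
      module N₁ = MarkedNet M₁
      module N₂ = MarkedNet M₂
    field
      A1 : N₁.initial ⨄ N₂.initial ⊨ E
      A2 : ∀ {ϱ₁ m₁′} → FiringSequence N₁.net N₁.initial ϱ₁ m₁′ →
           (∃ λ (m₂′ : Marking N₂.places) → m₁′ ⨄ m₂′ ⊨ E) ×
           (∀ (m₂′ : Marking N₂.places) → m₁′ ⨄ m₂′ ⊨ E →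
            ∃ λ ϱ₂ → FiringSequence N₂.net N₂.initial ϱ₂ m₂′ ×
                     N₁.labels ϱ₁ ≡ N₂.labels ϱ₂)

  _▷[_]_ : {Σ : Alphabet} → MarkedNet Σ → Formula → MarkedNet Σ → Set
  M₁ ▷[ E ] M₂ = (M₁ ⊒[ E ] M₂) × (M₂ ⊒[ E ] M₁)

{-# OPTIONS --safe #-}
module Submission where

open import Defs
open import Data.List.Base using (List; []; _∷_; mapMaybe)
open import Data.Maybe.Base using (just; nothing)
open import Data.Product.Base using (_,_)
open import Function.Base using (_∘_)
open import Relation.Binary.Definitions using (DecidableEquality)
open import Relation.Binary.PropositionalEquality
  using (_≡_; refl; cong; module ≡-Reasoning)

-- The labels of a sequence in N [ a / b ] are a function of its labels in N
-- alone, so sequences of two nets with equal labels keep equal labels.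

-- Relabeling leaves places, markings and firing untouched, so A1 and the existence part of A2 carry
-- over unchanged, and a sequence that matched before still leads to the right marking. Only
-- equality of label words needs proof: by `mapMaybe-relabel` both new words are images of the old
-- ones under one map.

module _ {Name Symbol : Set}
         (_≟ₙ_ : DecidableEquality Name) (_≟ₛ_ : DecidableEquality Symbol) where

  open PetriNets _≟ₙ_ _≟ₛ_

  -- A partial map on symbols, because `b` may be τ, which erases every `a`.
  relabelSymbols : Symbol → Label → List Symbol → List Symbol
  relabelSymbols a b = mapMaybe (relabel a b ∘ just)

  -- Holds because `relabel` fixes τ: deleting silent labels before relabeling loses nothing.
  mapMaybe-relabel : ∀ {A : Set} a b (l : A → Label) ts →
    mapMaybe (relabel a b ∘ l) ts ≡ relabelSymbols a b (mapMaybe l ts)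
  mapMaybe-relabel a b l []       = refl
  mapMaybe-relabel a b l (t ∷ ts) with l t
  ... | nothing = mapMaybe-relabel a b l ts
  ... | just s with relabel a b (just s)
  -- Here `s` is `a` and `b` is τ, so the symbol vanishes on both sides.
  ...   | nothing = mapMaybe-relabel a b l ts
  ...   | just u  = cong (u ∷_) (mapMaybe-relabel a b l ts)

  ⊒-relabel : ∀ {Σ} {N₁ N₂ : LabeledNet Σ} {m₁ m₂ E} a b →
    ⟨ N₁ , m₁ ⟩ ⊒[ E ] ⟨ N₂ , m₂ ⟩ →
    ⟨ N₁ [ a / b ] , m₁ ⟩ ⊒[ E ] ⟨ N₂ [ a / b ] , m₂ ⟩
  ⊒-relabel {N₁ = N₁} {N₂} a b N₁⊒N₂ = record
    { A1 = A1
    ; A2 = λ {ϱ₁} σ₁ → let (∃m₂′ , match) = A2 σ₁ in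
        ∃m₂′ , λ m₂′ m₁′⨄m₂′⊨E →
          let (ϱ₂ , σ₂ , l₁≡l₂) = match m₂′ m₁′⨄m₂′⊨E in
          ϱ₂ , σ₂ , (begin
            LabeledNet.labels (N₁ [ a / b ]) ϱ₁
              ≡⟨ mapMaybe-relabel a b N₁.label ϱ₁ ⟩
            relabelSymbols a b (N₁.labels ϱ₁)
              ≡⟨ cong (relabelSymbols a b) l₁≡l₂ ⟩
            relabelSymbols a b (N₂.labels ϱ₂)
              ≡⟨ mapMaybe-relabel a b N₂.label ϱ₂ ⟨
            LabeledNet.labels (N₂ [ a / b ]) ϱ₂ ∎)
    }
    where
    module N₁ = LabeledNet N₁
    module N₂ = LabeledNet N₂
    open _⊒[_]_ N₁⊒N₂
    open ≡-Reasoning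

theorem3 : {Name Symbol : Set}
    (_≟ₙ_ : DecidableEquality Name) (_≟ₛ_ : DecidableEquality Symbol) →
    let open PetriNets _≟ₙ_ _≟ₛ_ in
    {Σ : Alphabet} (N₁ N₂ : LabeledNet Σ)
    (m₁ : Marking (LabeledNet.places N₁)) (m₂ : Marking (LabeledNet.places N₂))
    (E : Formula) →
    ⟨ N₁ , m₁ ⟩ ▷[ E ] ⟨ N₂ , m₂ ⟩ →
    (a : Symbol) (b : Label) →
    ⟨ N₁ [ a / b ] , m₁ ⟩ ▷[ E ] ⟨ N₂ [ a / b ] , m₂ ⟩
theorem3 _≟ₙ_ _≟ₛ_ N₁ N₂ m₁ m₂ E (N₁⊒N₂ , N₂⊒N₁) a b =
  ⊒-relabel _≟ₙ_ _≟ₛ_ a b N₁⊒N₂ , ⊒-relabel _≟ₙ_ _≟ₛ_ a b N₂⊒N₁
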